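{- For every integer $n \equiv 1 \pmod 2$ with $n \geq 5$, there exists a $3$-connected biregular trigeodetic block on $\frac{n(3n-1)}{2}$ vertices having diameter $4$ or $5$ and degree sequence $\left(\frac{3(n-1)}{2}, 3\right)$.
   Context: Graphs are undirected, without loops or multiple edges. The distance between two vertices is the length (number of edges) of a shortest path connecting them, and the diameter of a graph is the greatest distance between any pair of its vertices. A graph is trigeodetic if each pair of nonadjacent vertices has at most $3$ distinct paths of minimum length between them. The vertex connectivity of a graph is the minimum number of vertices whose deletion (together with all edges incident to them) disconnects the graph. A graph is called $p$-connected if its vertex connectivity is equal to $p$ (equality, not merely at least $p$). A block is a graph whose vertex connectivity is $p > 1$. A graph $G$ is biregular with degree sequence $(l, k)$, where $l \neq k$ are fixed, if every vertex $v$ of $G$ satisfies $\deg(v) = l$ or $\deg(v) = k$. -}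

module Defs where

open import Data.List.Base using (List; length)
open import Data.List.Membership.Propositional using (_∈_; _∉_)
open import Data.List.Relation.Unary.All using (All)
open import Data.List.Relation.Unary.Unique.Propositional using (Unique)
open import Data.Fin.Base using (Fin)
open import Data.Nat.Base using (ℕ; suc; _≤_; _<_)
open import Data.Product.Base using (∃; ∃-syntax; _×_; proj₁)
open import Data.Sum.Base using (_⊎_)
open import Data.Vec.Base using (Vec; head; last)
open import Data.Vec.Relation.Unary.Linked using (Linked)
import Data.Vec.Relation.Unary.Unique.Propositional as Vec
open import Function.Base using (_on_)
open import Function.Bundles using (_↔_; _⇔_)
open import Relation.Binary.Core using (Rel)
open import Relation.Binary.Definitions using (Symmetric; Irreflexive)
open import Relation.Binary.PropositionalEquality using (_≡_; _≢_; cong)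
open import Relation.Nullary.Negation using (¬_)
open import Level using (0ℓ)

-- Adj need not be proof-irrelevant: degrees and paths below are counted by
-- vertices, never by proofs of adjacency, so there are no multiple edges.
record Graph : Set₁ where
  field
    V      : Set
    Adj    : Rel V 0ℓ
    sym    : Symmetric Adj
    irrefl : Irreflexive _≡_ Adj

open Graph public using (V; Adj)

HasOrder : Graph → ℕ → Set
HasOrder G m = Fin m ↔ V G

HasDegree : (G : Graph) → V G → ℕ → Set
HasDegree G v d =
  ∃[ ws ] Unique ws × length ws ≡ d × (∀ w → w ∈ ws ⇔ Adj G v w)

-- A path of length k is its sequence of k + 1 distinct vertices.
record IsPath (G : Graph) (u v : V G) {k : ℕ} (p : Vec (V G) (suc k)) : Set where
  field
    start    : head p ≡ u
    end      : last p ≡ v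
    linked   : Linked (Adj G) p
    distinct : Vec.Unique p

PathOfLength : (G : Graph) → V G → V G → ℕ → Set
PathOfLength G u v k = ∃[ p ] IsPath G u v {k} p

Distance : (G : Graph) → V G → V G → ℕ → Set
Distance G u v d =
  PathOfLength G u v d × (∀ k → PathOfLength G u v k → d ≤ k)

-- In particular, a graph with a diameter is connected.
Diameter : Graph → ℕ → Set
Diameter G D =
  (∃[ u ] ∃[ v ] Distance G u v D) ×
  (∀ u v → ∃[ d ] Distance G u v d × d ≤ D)

Trigeodetic : Graph → Set
Trigeodetic G =
  ∀ u v → u ≢ v → ¬ Adj G u v → ∀ d → Distance G u v d →
  (ps : List (Vec (V G) (suc d))) → Unique ps → All (IsPath G u v) ps →
  length ps ≤ 3

Connected : Graph → Set
Connected G = ∀ u v → ∃[ k ] PathOfLength G u v k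

infixl 6 _─_

_─_ : (G : Graph) → List (V G) → Graph
G ─ S = record
  { V      = ∃ (_∉ S)
  ; Adj    = Adj G on proj₁
  ; sym    = Graph.sym G
  ; irrefl = λ eq → Graph.irrefl G (cong proj₁ eq)
  }

-- Deleting every vertex does not count as disconnecting: the empty graph is
-- (vacuously) Connected.
Disconnects : (G : Graph) → List (V G) → Set
Disconnects G S = ¬ Connected (G ─ S)

VertexConnectivity : Graph → ℕ → Set
VertexConnectivity G p =
  (∃[ S ] Unique S × length S ≡ p × Disconnects G S) ×
  (∀ S → Unique S → Disconnects G S → p ≤ length S)

_-Connected_ : ℕ → Graph → Set
p -Connected G = VertexConnectivity G p

Block : Graph → Set
Block G = ∃[ p ] 1 < p × VertexConnectivity G p

Biregular : Graph → ℕ → ℕ → Set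
Biregular G l k = l ≢ k × (∀ v → HasDegree G v l ⊎ HasDegree G v k)

-- Write n = 2 m + 1. The n m progressions c, c + δ, c + 2 δ in ℤ/n with 1 ≤ δ ≤ m
-- form a 2-(n, 3, 3) design. Give every point a hub, inflate every progression to a
-- triangle on three corners, and join each corner to the hub of its point. On a
-- geodesic no three consecutive vertices are corners and no corner lies between two
-- hubs, so its vertices follow the pattern hub, corner, corner, hub, ...; two hubs
-- are thus joined by exactly three geodesics, of length 3, one for each progression
-- through the pair. These three are disjoint, as are the three exits of a corner
-- through its triangle, so deleting two vertices leaves all surviving corners
-- connected to hubs and all hubs connected to each other.
module Submission where

open import Defs
open import Data.Empty using (⊥; ⊥-elim)
open import Data.Fin.Base as Fin using (Fin; toℕ; punchIn; punchOut; combine; remQuot)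
open import Data.Fin.Patterns using (0F; 1F; 2F)
open import Data.Fin.Properties as Fin using (any?; injective⇒≤; *↔×; +↔⊎)
open import Data.List.Base using (List; []; _∷_; length; lookup; tabulate)
open import Data.List.Membership.Propositional using (_∈_; _∉_; lose)
open import Data.List.Membership.Propositional.Properties
  using (∈-lookup; ∈-tabulate⁺; ∈-tabulate⁻)
open import Data.List.Properties using (length-tabulate)
import Data.List.Relation.Unary.All as List
open import Data.List.Relation.Unary.All using (All; []; _∷_)
open import Data.List.Relation.Unary.AllPairs using ([]; _∷_)
open import Data.List.Relation.Unary.Any as Any using (Any)
open import Data.List.Relation.Unary.Any.Properties using (lookup-index)
open import Data.List.Relation.Unary.Unique.Propositional using (Unique)
open import Data.List.Relation.Unary.Unique.Propositional.Properties using (tabulate⁺)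
open import Data.Nat using
  (ℕ; zero; suc; _+_; _*_; _∸_; _/_; _%_; _≤_; _<_; z≤n; s≤s; s≤s⁻¹; _≤?_; _<?_; NonZero)
open import Data.Nat.Coprimality using (Coprime; coprime-divisor)
open import Data.Nat.DivMod
  using (_mod_; m%n<n; m%n%n≡m%n; m<n⇒m%n≡m; m≡m%n+[m/n]*n; m*n/n≡m; [m+n]%n≡m%n; %-distribˡ-+)
open import Data.Nat.Divisibility
  using (_∣_; divides; ∣-trans; ∣⇒≤; ∣1⇒≡1; ∣m⇒∣m*n; ∣m+n∣m⇒∣n; m%n≡0⇒n∣m)
open import Data.Nat.Properties as ℕ using (≤-refl; ≤-trans; ≤-antisym; m≤n⇒m≤1+n)
open import Data.Nat.Tactic.RingSolver using (solve-∀)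
open import Data.Product using (∃; ∃-syntax; Σ-syntax; _×_; _,_; proj₁; proj₂)
open import Data.Product.Function.NonDependent.Propositional using (_×-↔_)
import Data.Product.Properties as Product
open import Data.Sum using (_⊎_; inj₁; inj₂)
open import Data.Sum.Function.Propositional using (_⊎-↔_)
open import Data.Sum.Properties as Sum using (inj₂-injective)
open import Data.Vec.Base using (Vec; head; last; []; _∷_)
import Data.Vec.Relation.Unary.All as Vec
open import Data.Vec.Relation.Unary.All using ([]; _∷_)
open import Data.Vec.Relation.Unary.AllPairs using ([]; _∷_)
open import Data.Vec.Relation.Unary.Linked using (Linked; [-]; _∷_)
open import Function.Base using (_∘_)
open import Function.Bundles using (Inverse; Equivalence; _⇔_; mk⇔)
open import Function.Construct.Composition using (_↔-∘_)
open import Function.Construct.Identity using (↔-id)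
open import Relation.Binary.Definitions using (DecidableEquality)
import Relation.Binary.Definitions as Binary
open import Relation.Binary.PropositionalEquality
  using (_≡_; _≢_; refl; sym; trans; cong; cong₂; subst; module ≡-Reasoning)
open import Relation.Nullary using (¬_; Dec; yes; no; ¬?; contradiction)
open import Relation.Nullary.Decidable using (map′; _×-dec_; decidable-stable)
open import Relation.Unary using (Decidable)
open import Algebra.Properties.CommutativeSemigroup ℕ.+-commutativeSemigroup
  using (x∙yz≈y∙xz; xy∙z≈y∙xz)

-- Pigeonhole arguments on lists

lookup-injective : {A : Set} {xs : List A} → Unique xs →
  ∀ {i j} → lookup xs i ≡ lookup xs j → i ≡ j
lookup-injective {xs = _ ∷ _} _ {Fin.zero} {Fin.zero} _ = refl
lookup-injective {xs = _ ∷ _} (x∉ ∷ _) {Fin.zero} {Fin.suc j} eq =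
  contradiction eq (List.lookup x∉ (∈-lookup j))
lookup-injective {xs = _ ∷ _} (x∉ ∷ _) {Fin.suc i} {Fin.zero} eq =
  contradiction (sym eq) (List.lookup x∉ (∈-lookup i))
lookup-injective {xs = _ ∷ _} (_ ∷ u) {Fin.suc i} {Fin.suc j} eq =
  cong Fin.suc (lookup-injective u eq)

-- The code reads the proof of `P x` and not `x` itself, so that paths can be coded through their
-- normal forms. It injects the positions of the list into `Fin k`.
coded⇒length≤ : {A : Set} {P : A → Set} {k : ℕ}
  (code : ∀ {x} → P x → Fin k) →
  (∀ {x y} (px : P x) (py : P y) → code px ≡ code py → x ≡ y) →
  ∀ {xs} → Unique xs → All P xs → length xs ≤ k
coded⇒length≤ code injective unique all =
  injective⇒≤ {f = λ i → code (List.lookup all (∈-lookup i))}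
    (λ eq → lookup-injective unique (injective _ _ eq))

-- If each of the `k` disjoint classes met `xs`, choosing a position in each would inject `Fin k`
-- into fewer than `k` positions.
avoid : {A : Set} {k : ℕ} {P : Fin k → A → Set} → Binary.Decidable P →
  (∀ {i j x} → P i x → P j x → i ≡ j) →
  ∀ xs → length xs < k → ∃[ i ] (∀ {x} → P i x → x ∉ xs)
avoid {P = P} P? disjoint xs xs<k with any? (λ i → ¬? (Any.any? (P? i) xs))
... | yes (i , missed) = i , λ px x∈xs → missed (lose x∈xs px)
... | no all-hit = contradiction (injective⇒≤ {f = Any.index ∘ hit} injective) (ℕ.<⇒≱ xs<k)
  where
  hit : ∀ i → Any (P i) xs
  hit i = decidable-stable (Any.any? (P? i) xs) (λ missed → all-hit (i , missed))

  injective : ∀ {i j} → Any.index (hit i) ≡ Any.index (hit j) → i ≡ j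
  injective {i} {j} eq = disjoint (lookup-index (hit i))
    (subst (P j ∘ lookup xs) (sym eq) (lookup-index (hit j)))

least : {P : ℕ → Set} → Decidable P → ∀ {k} → P k →
  ∃[ d ] P d × d ≤ k × (∀ {j} → P j → d ≤ j)
least P? {zero} p = zero , p , z≤n , λ _ → z≤n
least {P} P? {suc k} p with P? zero
... | yes p₀ = zero , p₀ , z≤n , λ _ → z≤n
... | no ¬p₀ with d , pd , d≤k , minimal ← least (P? ∘ suc) p =
  suc d , pd , s≤s d≤k , λ { {zero} p₀ → contradiction p₀ ¬p₀ ; {suc j} pj → s≤s (minimal pj) }

-- Walks, geodesics and diameter

infixr 5 _by_▸_

-- Walks may repeat vertices, so they can be concatenated and reversed freely; `walk⇒path` turns
-- them into paths that are no longer.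
data Walk (G : Graph) : V G → V G → ℕ → Set where
  []     : ∀ {u} → Walk G u u 0
  _by_▸_ : ∀ {u v k} w → Adj G u w → Walk G w v k → Walk G u v (suc k)

module Walks (G : Graph) where

  vertices : ∀ {u v k} → Walk G u v k → Vec (V G) (suc k)
  vertices {u} []          = u ∷ []
  vertices {u} (_ by _ ▸ p) = u ∷ vertices p

  Reachable : V G → V G → Set
  Reachable u v = ∃ (Walk G u v)

  _++_ : ∀ {u v w k l} → Walk G u v k → Walk G v w l → Walk G u w (k + l)
  []          ++ q = q
  (x by e ▸ p) ++ q = x by e ▸ (p ++ q)

  reachable-trans : ∀ {u v w} → Reachable u v → Reachable v w → Reachable u w
  reachable-trans (_ , p) (_ , q) = _ , p ++ q

  reachable-sym : ∀ {u v} → Reachable u v → Reachable v u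
  reachable-sym (_ , [])        = _ , []
  reachable-sym (_ , (w by e ▸ p)) =
    reachable-trans (reachable-sym (_ , p)) (_ , (_ by Graph.sym G e ▸ []))

  -- Only the lower bound on the distance; that `d` is attained is a separate matter.
  Geodesic : V G → V G → ℕ → Set
  Geodesic u v d = ∀ {k} → Walk G u v k → d ≤ k

  linked⇒walk : ∀ {k} {p : Vec (V G) (suc k)} → Linked (Adj G) p →
    Σ[ w ∈ Walk G (head p) (last p) k ] vertices w ≡ p
  linked⇒walk {zero} {_ ∷ []} [-] = [] , refl
  linked⇒walk {suc k} {_ ∷ _ ∷ _} (e ∷ es) with w , eq ← linked⇒walk es =
    (_ by e ▸ w) , cong (_ ∷_) eq

  path⇒walk : ∀ {u v k} {p : Vec (V G) (suc k)} → IsPath G u v p →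
    Σ[ w ∈ Walk G u v k ] vertices w ≡ p
  path⇒walk record { start = refl ; end = refl ; linked = es } = linked⇒walk es

  module _ (_≟_ : DecidableEquality (V G)) where

    -- The step of loop erasure: before `u` is put in front of a path, an earlier visit to `u` must
    -- be cut out, and the part of the path from there on is itself a path.
    suffix-from : ∀ u {w v k} (p : Vec (V G) (suc k)) → IsPath G w v p →
      Vec.All (u ≢_) p ⊎ ∃[ l ] l ≤ k × PathOfLength G u v l
    suffix-from u {k = k} (x ∷ xs) path with u ≟ x
    ... | yes refl = inj₂ (k , ≤-refl , _ , record
      { start = refl ; end = end ; linked = linked ; distinct = distinct })
      where open IsPath path
    suffix-from u (x ∷ []) path | no u≢x = inj₁ (u≢x ∷ [])
    suffix-from u (x ∷ y ∷ ys) record { end = end ; linked = _ ∷ es ; distinct = _ ∷ ds } | no u≢x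
      with suffix-from u (y ∷ ys) record { start = refl ; end = end ; linked = es ; distinct = ds }
    ... | inj₁ u∉               = inj₁ (u≢x ∷ u∉)
    ... | inj₂ (l , l≤k , path) = inj₂ (l , m≤n⇒m≤1+n l≤k , path)

    walk⇒path : ∀ {u v k} → Walk G u v k → ∃[ l ] l ≤ k × PathOfLength G u v l
    walk⇒path {u} [] = 0 , z≤n , u ∷ [] , record
      { start = refl ; end = refl ; linked = [-] ; distinct = [] ∷ [] }
    walk⇒path {u} (w by e ▸ p) with walk⇒path p
    ... | l , l≤k , q@(_ ∷ _) , path@record { start = refl ; end = end ; linked = linked ; distinct = distinct }
      with suffix-from u q path
    ... | inj₁ u∉ = suc l , s≤s l≤k , u ∷ q , record
      { start = refl ; end = end ; linked = e ∷ linked ; distinct = u∉ ∷ distinct }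
    ... | inj₂ (l′ , l′≤l , path′) = l′ , m≤n⇒m≤1+n (≤-trans l′≤l l≤k) , path′

    reachable⇒connected : (∀ u v → Reachable u v) → Connected G
    reachable⇒connected reach u v with l , _ , path ← walk⇒path (reach u v .proj₂) = l , path

    -- Minimality among paths passes to walks because erasing loops never lengthens.
    distance⇒geodesic : ∀ {u v d} → Distance G u v d → Geodesic u v d
    distance⇒geodesic (_ , minimal) w with l , l≤k , path ← walk⇒path w =
      ≤-trans (minimal l path) l≤k

    geodesic⇒distance : ∀ {u v d} → Walk G u v d → Geodesic u v d → Distance G u v d
    geodesic⇒distance {u} {v} w geodesic with l , l≤d , path ← walk⇒path w =
      subst (PathOfLength G u v) (≤-antisym l≤d (shortest l path)) path , shortest
      where
      shortest : ∀ k → PathOfLength G u v k → _ ≤ k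
      shortest k (_ , p) = geodesic (path⇒walk p .proj₁)

    module _ {N : ℕ} (order : HasOrder G N) (adj? : Binary.Decidable (Adj G)) where

      anyV? : {P : V G → Set} → Decidable P → Dec (∃ P)
      anyV? {P} P? = map′ (λ (i , p) → to i , p)
        (λ (v , p) → from v , subst P (sym (strictlyInverseˡ v)) p) (any? (P? ∘ to))
        where open Inverse order

      walk? : ∀ u v k → Dec (Walk G u v k)
      walk? u v zero    = map′ (λ { refl → [] }) (λ { [] → refl }) (u ≟ v)
      walk? u v (suc k) = map′ (λ (w , e , p) → w by e ▸ p) (λ { (w by e ▸ p) → w , e , p })
        (anyV? (λ w → adj? u w ×-dec walk? w v k))

      distance : ∀ {u v k} → Walk G u v k → ∃[ d ] Distance G u v d × d ≤ k
      distance {u} {v} w with d , p , d≤k , minimal ← least (walk? u v) w =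
        d , geodesic⇒distance p minimal , d≤k

      -- A finite search over all pairs decides the disjunction: a pair farther apart than `D`
      -- realises `suc D`; otherwise all distances are at most `D`, and the given pair realises `D`.
      diameter : ∀ {D} → (∀ u v → ∃[ k ] k ≤ suc D × Walk G u v k) →
        ∃[ u ] ∃[ v ] Geodesic u v D → Diameter G D ⊎ Diameter G (suc D)
      diameter {D} short (x , y , geodesic) = far-or-near
        (anyV? (λ u → anyV? (λ v → D <? proj₁ (dist u v))))
        where
        dist : ∀ u v → ∃[ d ] Distance G u v d × d ≤ suc D
        dist u v with k , k≤ , w ← short u v with d , is-d , d≤k ← distance w =
          d , is-d , ≤-trans d≤k k≤

        exactly : ∀ {u v e} → (d : ∃[ d ] Distance G u v d × d ≤ e) → e ≤ proj₁ d →
          Distance G u v e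
        exactly {u} {v} (d , is-d , d≤e) e≤d = subst (Distance G u v) (≤-antisym d≤e e≤d) is-d

        far-or-near : Dec (∃[ u ] ∃[ v ] D < proj₁ (dist u v)) →
          Diameter G D ⊎ Diameter G (suc D)
        far-or-near (yes (u , v , far)) = inj₂ ((u , v , exactly (dist u v) far) , dist)
        far-or-near (no near) = inj₁ ((x , y , exactly (within x y) at-least) , within)
          where
          within : ∀ u v → ∃[ d ] Distance G u v d × d ≤ D
          within u v with d , is-d , _ ← dist u v in eq =
            d , is-d , ℕ.≮⇒≥ (λ far → near (u , v , subst (D <_) (sym (cong proj₁ eq)) far))

          at-least : D ≤ proj₁ (within x y)
          at-least = geodesic (path⇒walk (within x y .proj₂ .proj₁ .proj₁ .proj₂) .proj₁)


-- The first step of any walk leaving `v` would land on a deleted neighbour.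
separated-by-neighbours : (G : Graph) {v : V G} {ns : List (V G)} →
  (∀ w → w ∈ ns ⇔ Adj G v w) → ∀ {u} → u ∉ ns → u ≢ v → Disconnects G ns
separated-by-neighbours G {v} {ns} neighbours {u} u∉ u≢v connected =
  no-walk (path⇒walk (connected (v , v∉) (u , u∉) .proj₂ .proj₂) .proj₁)
  where
  open Walks (G ─ ns)

  v∉ : v ∉ ns
  v∉ v∈ = Graph.irrefl G refl (Equivalence.to (neighbours v) v∈)

  no-walk : ∀ {k} → ¬ Walk (G ─ ns) (v , v∉) (u , u∉) k
  no-walk []                  = u≢v refl
  no-walk ((w , w∉) by e ▸ _) = w∉ (Equivalence.from (neighbours w) e)

-- Labelled triple systems

third : Fin 3 → Fin 3 → Fin 3
third 0F 1F = 2F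
third 1F 0F = 2F
third 0F 2F = 1F
third 2F 0F = 1F
third 1F 2F = 0F
third 2F 1F = 0F
-- Only equal labels are left; the value is a default.
third s  _  = s

-- A 2-(v, 3, 3) design whose triples are labelled by Fin 3 in such a way that
-- the three triples through a pair are told apart by the label of their third point.
record TripleSystem (r : ℕ) : Set₁ where
  infix 4 _≟ᵖ_ _≟ᵗ_
  field
    Point Triple     : Set
    _≟ᵖ_            : DecidableEquality Point
    _≟ᵗ_            : DecidableEquality Triple
    point           : Triple → Fin 3 → Point
    point-injective : ∀ b {s t} → point b s ≡ point b t → s ≡ t
    join            : ∀ {i j} → i ≢ j → ∀ κ → ∃[ b ] ∃[ s ] ∃[ t ]
                      point b s ≡ i × point b t ≡ j × third s t ≡ κ
    join-unique     : ∀ {b c s s′ t t′} → point b s ≡ point c s′ → point b t ≡ point c t′ →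
                      s ≢ t → s′ ≢ t′ → third s t ≡ third s′ t′ → b ≡ c
    flag            : Point → Fin r → Triple × Fin 3
    flag-injective  : ∀ i {k l} → flag i k ≡ flag i l → k ≡ l
    flag-incident   : ∀ i k → let b , t = flag i k in point b t ≡ i
    flag-complete   : ∀ b t → ∃[ k ] flag (point b t) k ≡ (b , t)

-- The inflated graph and its degrees

module Inflation {r : ℕ} (T : TripleSystem r) where
  open TripleSystem T

  Vertex : Set
  Vertex = Point ⊎ Triple × Fin 3

  pattern hub i      = inj₁ i
  pattern corner b t = inj₂ (b , t)

  infix 4 _~_ _~?_ _≟_

  _~_ : Vertex → Vertex → Set
  hub i      ~ hub j      = ⊥
  hub i      ~ corner b t = point b t ≡ i
  corner b t ~ hub i      = point b t ≡ i
  corner b s ~ corner c t = b ≡ c × s ≢ t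

  ~-sym : ∀ {u v} → u ~ v → v ~ u
  ~-sym {hub _}      {corner _ _} eq         = eq
  ~-sym {corner _ _} {hub _}      eq         = eq
  ~-sym {corner _ _} {corner _ _} (eq , s≢t) = sym eq , s≢t ∘ sym

  ~-irrefl : ∀ {u v} → u ≡ v → ¬ u ~ v
  ~-irrefl {corner _ _} refl (_ , s≢s) = s≢s refl

  G : Graph
  G = record { V = Vertex ; Adj = _~_ ; sym = λ {u} → ~-sym {u} ; irrefl = ~-irrefl }

  open Walks G

  _≟_ : DecidableEquality Vertex
  _≟_ = Sum.≡-dec _≟ᵖ_ (Product.≡-dec _≟ᵗ_ Fin._≟_)

  _~?_ : ∀ u v → Dec (u ~ v)
  hub _      ~? hub _      = no λ ()
  hub i      ~? corner b t = point b t ≟ᵖ i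
  corner b t ~? hub i      = point b t ≟ᵖ i
  corner b s ~? corner c t = b ≟ᵗ c ×-dec ¬? (s Fin.≟ t)

  -- The flags at `i` are the corners around its hub: `flag-injective` excludes repetitions and
  -- `flag-complete` omissions.
  hub-degree : ∀ i → HasDegree G (hub i) r
  hub-degree i = tabulate (inj₂ ∘ flag i)
    , tabulate⁺ (flag-injective i ∘ inj₂-injective)
    , length-tabulate (inj₂ ∘ flag i)
    , λ w → mk⇔ (to w) (from w)
    where
    to : ∀ w → w ∈ tabulate (inj₂ ∘ flag i) → hub i ~ w
    to w w∈ with k , refl ← ∈-tabulate⁻ {f = inj₂ ∘ flag i} w∈ = flag-incident i k

    from : ∀ w → hub i ~ w → w ∈ tabulate (inj₂ ∘ flag i)
    from (corner b t) refl with k , eq ← flag-complete b t =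
      subst (λ f → inj₂ f ∈ tabulate (inj₂ ∘ flag i)) eq (∈-tabulate⁺ k)

  sibling : Triple → Fin 3 → Fin 2 → Vertex
  sibling b t k = corner b (punchIn t k)

  corner-neighbours : Triple → Fin 3 → List Vertex
  corner-neighbours b t = hub (point b t) ∷ tabulate (sibling b t)

  ∈-corner-neighbours : ∀ b t w → w ∈ corner-neighbours b t ⇔ corner b t ~ w
  ∈-corner-neighbours b t w = mk⇔ (to w) (from w)
    where
    to : ∀ w → w ∈ corner-neighbours b t → corner b t ~ w
    to w (Any.here refl) = refl
    to w (Any.there w∈) with k , refl ← ∈-tabulate⁻ {f = sibling b t} w∈ = refl , Fin.punchInᵢ≢i t k ∘ sym

    from : ∀ w → corner b t ~ w → w ∈ corner-neighbours b t
    from (hub _)      refl         = Any.here refl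
    from (corner _ s) (refl , t≢s) = Any.there
      (subst (λ s → corner b s ∈ tabulate (sibling b t)) (Fin.punchIn-punchOut t≢s)
        (∈-tabulate⁺ {f = sibling b t} (punchOut t≢s)))

  corner-neighbours-unique : ∀ b t → Unique (corner-neighbours b t)
  corner-neighbours-unique b t =
    (List.tabulate λ w∈ eq → hub∉ (subst (_∈ _) (sym eq) w∈))
    ∷ tabulate⁺ {f = sibling b t} (Fin.punchIn-injective t _ _ ∘ cong proj₂ ∘ inj₂-injective)
    where
    hub∉ : hub (point b t) ∉ tabulate (sibling b t)
    hub∉ hub∈ with () ← ∈-tabulate⁻ {f = sibling b t} hub∈ .proj₂

  corner-degree : ∀ b t → HasDegree G (corner b t) 3
  corner-degree b t = corner-neighbours b t , corner-neighbours-unique b t , refl , ∈-corner-neighbours b t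

  biregular : r ≢ 3 → Biregular G r 3
  biregular r≢3 = r≢3 , λ { (hub i) → inj₁ (hub-degree i) ; (corner b t) → inj₂ (corner-degree b t) }

  -- Connectivity

  join-distinct : ∀ {i j} (i≢j : i ≢ j) {κ κ′} →
    proj₁ (join i≢j κ) ≡ proj₁ (join i≢j κ′) → κ ≡ κ′
  join-distinct i≢j {κ} {κ′} eq
    with b , s , t , bs , bt , refl ← join i≢j κ
    with _ , s′ , t′ , bs′ , bt′ , refl ← join i≢j κ′
    with refl ← eq
    = cong₂ third (point-injective b (trans bs (sym bs′))) (point-injective b (trans bt (sym bt′)))

  labels-distinct : ∀ {i j b s t} → i ≢ j → point b s ≡ i → point b t ≡ j → s ≢ t
  labels-distinct i≢j refl bt refl = i≢j bt

  module _ (S : List Vertex) (S<3 : length S < 3) where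
    private module D = Walks (G ─ S)

    -- The three triples joining `i` and `j` are distinct by `join-distinct`, so their corners form
    -- three disjoint classes, and fewer than three deletions miss one of them.
    intact-triple : ∀ {i j} (i≢j : i ≢ j) →
      ∃[ κ ] (∀ {t} → corner (proj₁ (join i≢j κ)) t ∉ S)
    intact-triple i≢j = let κ , missed = avoid on-triple? disjoint S S<3 in κ , missed refl
      where
      OnTriple : Fin 3 → Vertex → Set
      OnTriple κ (hub _)      = ⊥
      OnTriple κ (corner c _) = proj₁ (join i≢j κ) ≡ c

      on-triple? : Binary.Decidable OnTriple
      on-triple? κ (hub _)      = no λ ()
      on-triple? κ (corner c _) = proj₁ (join i≢j κ) ≟ᵗ c

      disjoint : ∀ {κ κ′ x} → OnTriple κ x → OnTriple κ′ x → κ ≡ κ′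
      disjoint {x = corner _ _} p q = join-distinct i≢j (trans p (sym q))

    -- The three points of a triple are distinct, so its exits, each a corner with its hub, are
    -- disjoint.
    intact-exit : ∀ b → ∃[ s ] corner b s ∉ S × hub (point b s) ∉ S
    intact-exit b =
      let s , missed = avoid on-exit? disjoint S S<3 in s , missed (refl , refl) , missed refl
      where
      OnExit : Fin 3 → Vertex → Set
      OnExit s (hub i)       = point b s ≡ i
      OnExit s (corner c s′) = s ≡ s′ × b ≡ c

      on-exit? : Binary.Decidable OnExit
      on-exit? s (hub i)       = point b s ≟ᵖ i
      on-exit? s (corner c s′) = s Fin.≟ s′ ×-dec b ≟ᵗ c

      disjoint : ∀ {s s′ x} → OnExit s x → OnExit s′ x → s ≡ s′
      disjoint {x = hub _}      p       q       = point-injective b (trans p (sym q))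
      disjoint {x = corner _ _} (p , _) (q , _) = trans p (sym q)

    hubs-reachable : ∀ {i j} (i∉ : hub i ∉ S) (j∉ : hub j ∉ S) →
      D.Reachable (hub i , i∉) (hub j , j∉)
    hubs-reachable {i} {j} i∉ j∉ with i ≟ᵖ j
    ... | yes refl = _ , []
    ... | no i≢j with κ , corner∉ ← intact-triple i≢j
      with b , s , t , bs , bt , _ ← join i≢j κ = _ ,
      ( (corner b s , corner∉) by bs ▸
        (corner b t , corner∉) by (refl , labels-distinct i≢j bs bt) ▸
        (hub j , j∉) by bt ▸ [] )

    hub-reachable : ∀ v (v∉ : v ∉ S) →
      ∃[ i ] Σ[ i∉ ∈ hub i ∉ S ] D.Reachable (v , v∉) (hub i , i∉)
    hub-reachable (hub i)      i∉ = i , i∉ , _ , []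
    hub-reachable (corner b t) v∉ with s , corner∉ , hub∉ ← intact-exit b with t Fin.≟ s
    ... | yes refl = point b t , hub∉ , _ , ((hub _ , hub∉) by refl ▸ [])
    ... | no t≢s = point b s , hub∉ , _ ,
      ((corner b s , corner∉) by (refl , t≢s) ▸ (hub _ , hub∉) by refl ▸ [])

    deletion-connected : Connected (G ─ S)
    deletion-connected = D.reachable⇒connected _≟ᴰ_ λ (u , u∉) (v , v∉) →
      let i , i∉ , u⇝i = hub-reachable u u∉
          j , j∉ , v⇝j = hub-reachable v v∉
      in D.reachable-trans u⇝i (D.reachable-trans (hubs-reachable i∉ j∉) (D.reachable-sym v⇝j))
      where
      -- Negations are definitionally proof-irrelevant, so the vertices of G ─ S
      -- are compared by their underlying vertices.
      _≟ᴰ_ : DecidableEquality (V (G ─ S))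
      (u , _) ≟ᴰ (v , _) = map′ (λ { refl → refl }) (cong proj₁) (u ≟ v)

  -- The cut isolates the corner labelled `0F` from the hub of the point labelled `1F`, which is not
  -- among its neighbours. Fewer deletions fail by `deletion-connected`.
  3-connected : Triple → 3 -Connected G
  3-connected b =
    ( corner-neighbours b 0F , corner-neighbours-unique b 0F , refl
    , separated-by-neighbours G (∈-corner-neighbours b 0F) {hub (point b 1F)}
        (λ hub∈ → hub-apart (Equivalence.to (∈-corner-neighbours b 0F _) hub∈)) (λ ()) )
    , λ S _ disconnects → ℕ.≮⇒≥ (λ S<3 → disconnects (deletion-connected S S<3))
    where
    hub-apart : point b 0F ≢ point b 1F
    hub-apart eq with () ← point-injective b eq

  -- Normal forms of geodesics

  data FromHub (i : Point) : Vertex → ℕ → Set where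
    -- An equation is stored so that matching two forms with the same end need not unify values of
    -- `point`.
    stop : ∀ {j} → i ≡ j → FromHub i (hub j) 0
    half : ∀ b s → point b s ≡ i → FromHub i (corner b s) 1
    edge : ∀ b s t → point b s ≡ i → s ≢ t → FromHub i (corner b t) 2
    full : ∀ b s t {v d} → point b s ≡ i → s ≢ t → FromHub (point b t) v d →
           FromHub i v (3 + d)

  -- A form that starts at a corner and reaches a hub does so either directly (`up`) or through a
  -- sibling corner (`across`); from there on it continues as from any hub.
  data Reduced : Vertex → Vertex → ℕ → Set where
    from   : ∀ {i v d} → FromHub i v d → Reduced (hub i) v d
    stop   : ∀ {b t} → Reduced (corner b t) (corner b t) 0
    side   : ∀ {b s t} → s ≢ t → Reduced (corner b s) (corner b t) 1
    up     : ∀ {b t v d} → FromHub (point b t) v d → Reduced (corner b t) v (1 + d)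
    across : ∀ {b s t v d} → s ≢ t → FromHub (point b t) v d → Reduced (corner b s) v (2 + d)

  hub-track : ∀ {i v d} → FromHub i v d → Vec Vertex (1 + d)
  hub-track {i} (stop _)           = hub i ∷ []
  hub-track {i} (half b s _)       = hub i ∷ corner b s ∷ []
  hub-track {i} (edge b s t _ _)   = hub i ∷ corner b s ∷ corner b t ∷ []
  hub-track {i} (full b s t _ _ f) = hub i ∷ corner b s ∷ corner b t ∷ hub-track f

  track : ∀ {u v d} → Reduced u v d → Vec Vertex (1 + d)
  track (from f)                           = hub-track f
  track (stop {b} {t})                     = corner b t ∷ []
  track (side {b} {s} {t} _)               = corner b s ∷ corner b t ∷ []
  track (up {b} {t} f)                     = corner b t ∷ hub-track f
  track (across {b} {s} {t} _ f)           = corner b s ∷ corner b t ∷ hub-track f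

  geodesic-tail : ∀ {u w v d} → u ~ w → Geodesic u v (suc d) → Geodesic w v d
  geodesic-tail e geodesic p = s≤s⁻¹ (geodesic (_ by e ▸ p))

  no-return : ∀ {i j b t v d} → point b t ≡ i → point b t ≡ j → Walk G (hub j) v d →
    ¬ Geodesic (hub i) v (2 + d)
  no-return refl refl p geodesic = ℕ.<-irrefl refl (≤-trans (m≤n⇒m≤1+n ≤-refl) (geodesic p))

  -- Two steps inside a triangle can be replaced by none, if they return to the start, or else by
  -- one.
  no-detour : ∀ {b s t v d} → Walk G (corner b t) v d → ¬ Geodesic (corner b s) v (2 + d)
  no-detour {b} {s} {t} p geodesic with s Fin.≟ t
  ... | yes refl = ℕ.<-irrefl refl (≤-trans (m≤n⇒m≤1+n ≤-refl) (geodesic p))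
  ... | no s≢t   = ℕ.<-irrefl refl (geodesic (corner b t by (refl , s≢t) ▸ p))

  -- The walk is read three steps at a time; every continuation off the pattern is excluded by
  -- `no-return` or `no-detour`.
  reduce-hub : ∀ {i v d} (p : Walk G (hub i) v d) → Geodesic (hub i) v d →
    Σ[ f ∈ FromHub i v d ] hub-track f ≡ vertices p
  reduce-hub [] _ = stop refl , refl
  reduce-hub (corner b s by bs ▸ []) _ = half b s bs , refl
  reduce-hub (corner b s by bs ▸ hub j by bs′ ▸ p) geodesic =
    ⊥-elim (no-return bs bs′ p geodesic)
  reduce-hub (corner b s by bs ▸ corner b t by (refl , s≢t) ▸ []) _ = edge b s t bs s≢t , refl
  reduce-hub (corner b s by bs ▸ corner b t by (refl , s≢t) ▸ hub _ by refl ▸ p) geodesic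
    with f , eq ← reduce-hub p (geodesic-tail {corner b t} refl (geodesic-tail {corner b s} (refl , s≢t)
                                 (geodesic-tail {hub _} {corner b s} bs geodesic))) =
    full b s t bs s≢t f , cong (λ vs → _ ∷ _ ∷ _ ∷ vs) eq
  reduce-hub (corner b s by bs ▸ corner b t by (refl , s≢t) ▸ corner b t′ by (refl , t≢t′) ▸ p) geodesic =
    ⊥-elim (no-detour p (geodesic-tail {hub _} {corner b s} bs geodesic))

  reduce : ∀ {u v d} (p : Walk G u v d) → Geodesic u v d →
    Σ[ q ∈ Reduced u v d ] track q ≡ vertices p
  reduce {hub i} p geodesic with f , eq ← reduce-hub p geodesic = from f , eq
  reduce {corner b t} [] _ = stop , refl
  reduce {corner b t} (hub _ by refl ▸ p) geodesic
    with f , eq ← reduce-hub p (geodesic-tail {corner b t} refl geodesic) = up f , cong (_ ∷_) eq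
  reduce {corner b s} (corner b t by (refl , s≢t) ▸ []) _ = side s≢t , refl
  reduce {corner b s} (corner b t by (refl , s≢t) ▸ hub _ by refl ▸ p) geodesic
    with f , eq ← reduce-hub p (geodesic-tail {corner b t} refl
                                 (geodesic-tail {corner b s} (refl , s≢t) geodesic)) =
    across s≢t f , cong (λ vs → _ ∷ _ ∷ vs) eq
  reduce {corner b s} (corner b t by (refl , s≢t) ▸ corner b t′ by (refl , t≢t′) ▸ p) geodesic =
    ⊥-elim (no-detour p geodesic)

  -- Upper bounds on distances

  anchor : Vertex → Point
  anchor (hub i)      = i
  anchor (corner b t) = point b t

  rank : Vertex → ℕ
  rank (hub _)      = 0
  rank (corner _ _) = 1

  -- An upper bound on the distance: `rank` is the distance to the hub of the anchor, and two hubs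
  -- are at most 3 apart.
  radius : ∀ u v → ℕ
  radius u v = rank u + (3 + rank v)

  to-anchor : ∀ u → Walk G u (hub (anchor u)) (rank u)
  to-anchor (hub i)      = []
  to-anchor (corner b t) = hub _ by refl ▸ []

  from-anchor : ∀ u → Walk G (hub (anchor u)) u (rank u)
  from-anchor (hub i)      = []
  from-anchor (corner b t) = corner b t by refl ▸ []

  hub-walk : ∀ i j → ∃[ k ] k ≤ 3 × Walk G (hub i) (hub j) k
  hub-walk i j with i ≟ᵖ j
  ... | yes refl = 0 , z≤n , []
  ... | no i≢j with b , s , t , bs , bt , _ ← join i≢j 0F = 3 , ≤-refl ,
    (corner b s by bs ▸ corner b t by (refl , labels-distinct i≢j bs bt) ▸ hub j by bt ▸ [])

  short-walk : ∀ u v → ∃[ k ] k ≤ radius u v × Walk G u v k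
  short-walk u v with k , k≤3 , p ← hub-walk (anchor u) (anchor v) =
    rank u + (k + rank v) , ℕ.+-monoʳ-≤ (rank u) (ℕ.+-monoˡ-≤ (rank v) k≤3) ,
    to-anchor u ++ (p ++ from-anchor v)

  -- Counting geodesics

  join-labels : ∀ {i j b c s s′ t t′} → point b s ≡ i → point c s′ ≡ i →
    point b t ≡ j → point c t′ ≡ j → s ≢ t → s′ ≢ t′ → third s t ≡ third s′ t′ →
    b ≡ c × s ≡ s′ × t ≡ t′
  join-labels {b = b} bs cs bt ct s≢t s′≢t′ eq
    with refl ← join-unique (trans bs (sym cs)) (trans bt (sym ct)) s≢t s′≢t′ eq
    with refl ← point-injective b (trans bs (sym cs))
    with refl ← point-injective b (trans bt (sym ct))
    = refl , refl , refl

  -- A geodesic is determined by its ends and either by the label of the corner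
  -- through which it leaves its first triple or, if it runs along a triple
  -- joining the hubs of its ends, by the label of the unused corner of that triple.
  code : ∀ {u v d} → Reduced u v d → Fin 3
  code (from (full b s t _ _ _))     = third s t
  code (from _)                      = 0F
  code stop                          = 0F
  code (side _)                      = 0F
  code (up (full b s t _ _ _))       = third s t
  code (up {b} {t} _)                = t
  code (across {b} {s} {t} _ _)      = t

  -- Within the radius a form contains at most one `full`, and its triple then joins the anchors of
  -- the ends, so `join-labels` identifies it. Without `full`, the first exit is fixed by the code
  -- or by the end, and `point-injective` fixes the corner at which the last triple is entered.
  code-injective : ∀ {u v d} → u ≢ v → ¬ u ~ v → d ≤ radius u v →
    (p q : Reduced u v d) → code p ≡ code q → track p ≡ track q
  code-injective u≢v _ _ (from (stop refl)) _ _ = contradiction refl u≢v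
  code-injective _ _ _ (from (full b s t bs s≢t (stop bt))) (from (full c s′ t′ cs s′≢t′ (stop ct))) eq
    with refl , refl , refl ← join-labels bs cs bt ct s≢t s′≢t′ eq = refl
  -- The radius of two hubs is 3, but two full triples take at least 6 steps; the other absurd
  -- bounds are alike.
  code-injective _ _ (s≤s (s≤s (s≤s ()))) (from {v = hub _} (full _ _ _ _ _ (full _ _ _ _ _ _))) _ _
  code-injective _ u≁v _ (from (half _ _ bs)) _ _ = contradiction bs u≁v
  code-injective _ _ _ (from (edge b s t bs _)) (from (edge b s′ t cs _)) _
    with refl ← point-injective b (trans bs (sym cs)) = refl
  code-injective _ _ _ (from (full b s t bs s≢t (half b′ s′ bt))) (from (full c s″ t″ cs s″≢t″ (half b′ s′ ct))) eq
    with refl , refl , refl ← join-labels bs cs (sym bt) (sym ct) s≢t s″≢t″ eq = refl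
  code-injective _ _ (s≤s (s≤s (s≤s (s≤s ())))) (from {v = corner _ _} (full _ _ _ _ _ (edge _ _ _ _ _))) _ _
  code-injective _ _ (s≤s (s≤s (s≤s (s≤s ())))) (from {v = corner _ _} (full _ _ _ _ _ (full _ _ _ _ _ _))) _ _
  code-injective u≢v _ _ stop _ _ = contradiction refl u≢v
  code-injective _ u≁v _ (side s≢t) _ _ = contradiction (refl , s≢t) u≁v
  code-injective _ u≁v _ (up (stop bt)) _ _ = contradiction bt u≁v
  code-injective _ _ _ (up (half _ _ _)) (up (half _ _ _)) _ = refl
  code-injective _ _ _ (up (edge b _ _ bs _)) (up (edge _ _ _ cs _)) _
    with refl ← point-injective b (trans bs (sym cs)) = refl
  -- Both forms have length 3, but their codes are the labels of different exits from the first
  -- triangle.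
  code-injective _ _ _ (up (edge _ _ _ _ _)) (across s≢t (half _ _ _)) eq = contradiction eq s≢t
  code-injective _ _ _ (across s≢t (half _ _ _)) (up (edge _ _ _ _ _)) eq = contradiction (sym eq) s≢t
  code-injective _ _ _ (across _ (half _ _ _)) (across _ (half _ _ _)) refl = refl
  code-injective _ _ _ (across _ (edge b _ _ bs _)) (across _ (edge _ _ _ cs _)) refl
    with refl ← point-injective b (trans bs (sym cs)) = refl
  code-injective _ _ _ (across {b} {t = t} _ (stop bt)) (across {t = t′} _ (stop bt′)) _
    with refl ← point-injective b (trans bt (sym bt′)) = refl
  code-injective _ _ _ (up (full b s t bs s≢t (stop bt))) (up (full c s′ t′ cs s′≢t′ (stop ct))) eq
    with refl , refl , refl ← join-labels bs cs bt ct s≢t s′≢t′ eq = refl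
  code-injective _ _ _ (up (full b s t bs s≢t (half b′ s′ bt))) (up (full c s″ t″ cs s″≢t″ (half b′ s′ ct))) eq
    with refl , refl , refl ← join-labels bs cs (sym bt) (sym ct) s≢t s″≢t″ eq = refl
  code-injective _ _ (s≤s (s≤s (s≤s (s≤s ())))) (up {v = hub _} (full _ _ _ _ _ (full _ _ _ _ _ _))) _ _
  code-injective _ _ (s≤s (s≤s (s≤s (s≤s (s≤s ()))))) (up {v = corner _ _} (full _ _ _ _ _ (edge _ _ _ _ _))) _ _
  code-injective _ _ (s≤s (s≤s (s≤s (s≤s (s≤s ()))))) (up {v = corner _ _} (full _ _ _ _ _ (full _ _ _ _ _ _))) _ _
  code-injective _ _ (s≤s (s≤s (s≤s (s≤s ())))) (across {v = hub _} _ (full _ _ _ _ _ _)) _ _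
  code-injective _ _ (s≤s (s≤s (s≤s (s≤s (s≤s ()))))) (across {v = corner _ _} _ (full _ _ _ _ _ (half _ _ _))) _ _
  code-injective _ _ (s≤s (s≤s (s≤s (s≤s (s≤s ()))))) (across {v = corner _ _} _ (full _ _ _ _ _ (edge _ _ _ _ _))) _ _
  code-injective _ _ (s≤s (s≤s (s≤s (s≤s (s≤s ()))))) (across {v = corner _ _} _ (full _ _ _ _ _ (full _ _ _ _ _ _))) _ _
  -- Equal lengths would leave a remainder of length 0 after `full`, which cannot end at a corner.
  code-injective _ _ _ (up (full _ _ _ _ _ (half _ _ _))) (across _ (full _ _ _ _ _ ())) _
  code-injective _ _ _ (across _ (edge _ _ _ _ _)) (up (full _ _ _ _ _ ())) _

  trigeodetic : Trigeodetic G
  trigeodetic u v u≢v u≁v d distance-d ps unique paths =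
    coded⇒length≤ (code ∘ proj₁ ∘ reduced) injective unique paths
    where
    geodesic : Geodesic u v d
    geodesic = distance⇒geodesic _≟_ distance-d

    d≤radius : d ≤ radius u v
    d≤radius with k , k≤ , p ← short-walk u v = ≤-trans (geodesic p) k≤

    reduced : ∀ {p} → IsPath G u v p → Σ[ q ∈ Reduced u v d ] track q ≡ p
    reduced path with w , eq ← path⇒walk path with q , eq′ ← reduce w geodesic =
      q , trans eq′ eq

    injective : ∀ {p q} (is-p : IsPath G u v p) (is-q : IsPath G u v q) →
      code (proj₁ (reduced is-p)) ≡ code (proj₁ (reduced is-q)) → p ≡ q
    injective is-p is-q eq = trans (sym (proj₂ (reduced is-p)))
      (trans (code-injective u≢v u≁v d≤radius (proj₁ (reduced is-p)) (proj₁ (reduced is-q)) eq) (proj₂ (reduced is-q)))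

  -- The diameter

  -- Reaching another hub already takes three steps, so a corner reached within three steps lies on
  -- a triple through `j`.
  far-from-triple : ∀ {j b} → (∀ t → point b t ≢ j) → Geodesic (hub j) (corner b 0F) 4
  far-from-triple j∉b (corner _ _ by bt ▸ []) = contradiction bt (j∉b _)
  far-from-triple j∉b (corner _ _ by bt ▸ corner _ _ by (refl , _) ▸ []) = contradiction bt (j∉b _)
  far-from-triple j∉b (corner _ _ by bt ▸ corner _ _ by (refl , _) ▸ corner _ _ by (refl , _) ▸ []) =
    contradiction bt (j∉b _)
  far-from-triple j∉b (corner _ _ by bt ▸ hub _ by bt′ ▸ corner _ t by bt″ ▸ []) =
    contradiction (trans bt″ (trans (sym bt′) bt)) (j∉b t)
  far-from-triple j∉b (_ by _ ▸ _ by _ ▸ _ by _ ▸ _ by _ ▸ _) = s≤s (s≤s (s≤s (s≤s z≤n)))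

  diameter-4-or-5 : ∀ {N} → HasOrder G N → (b : Triple) (j : Point) → (∀ t → point b t ≢ j) →
    Diameter G 4 ⊎ Diameter G 5
  diameter-4-or-5 order b j j∉b = diameter _≟_ order _~?_ short (hub j , corner b 0F , far-from-triple j∉b)
    where
    rank≤1 : ∀ u → rank u ≤ 1
    rank≤1 (hub _)      = z≤n
    rank≤1 (corner _ _) = ≤-refl

    short : ∀ u v → ∃[ k ] k ≤ 5 × Walk G u v k
    short u v with k , k≤ , p ← short-walk u v =
      k , ≤-trans k≤ (ℕ.+-mono-≤ (rank≤1 u) (ℕ.+-monoʳ-≤ 3 (rank≤1 v))) , p

-- Labels in the cyclic design

lower upper : Fin 3 → Fin 3
lower 0F = 1F
lower 1F = 0F
lower 2F = 0F
upper 0F = 2F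
upper 1F = 2F
upper 2F = 1F

-- Along a progression the two labels other than `κ` are `gap κ` steps apart.
gap : Fin 3 → ℕ
gap 0F = 1
gap 1F = 2
gap 2F = 1

upper≡lower+gap : ∀ κ → toℕ (upper κ) ≡ toℕ (lower κ) + gap κ
upper≡lower+gap 0F = refl
upper≡lower+gap 1F = refl
upper≡lower+gap 2F = refl

third-lower-upper : ∀ κ → third (lower κ) (upper κ) ≡ κ
third-lower-upper 0F = refl
third-lower-upper 1F = refl
third-lower-upper 2F = refl

third-upper-lower : ∀ κ → third (upper κ) (lower κ) ≡ κ
third-upper-lower 0F = refl
third-upper-lower 1F = refl
third-upper-lower 2F = refl

orient : ∀ {s t} → s ≢ t → let κ = third s t in
  s ≡ lower κ × t ≡ upper κ ⊎ s ≡ upper κ × t ≡ lower κ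
orient {0F} {0F} s≢t = contradiction refl s≢t
orient {0F} {1F} _   = inj₁ (refl , refl)
orient {0F} {2F} _   = inj₁ (refl , refl)
orient {1F} {0F} _   = inj₂ (refl , refl)
orient {1F} {1F} s≢t = contradiction refl s≢t
orient {1F} {2F} _   = inj₁ (refl , refl)
orient {2F} {0F} _   = inj₂ (refl , refl)
orient {2F} {1F} _   = inj₂ (refl , refl)
orient {2F} {2F} s≢t = contradiction refl s≢t

gap-nonZero : ∀ κ → NonZero (gap κ)
gap-nonZero 0F = _
gap-nonZero 1F = _
gap-nonZero 2F = _

gap∣2 : ∀ κ → gap κ ∣ 2
gap∣2 0F = divides 2 refl
gap∣2 1F = divides 1 refl
gap∣2 2F = divides 2 refl

-- As N is odd, i ≠ j differ by ± δ for exactly one δ ∈ {1, …, m} and by ± 2 δ for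
-- exactly one, so each of the three pairs of labels joins i and j once.
module Cyclic (m : ℕ) where

  N : ℕ
  N = suc (2 * m)

  -- Translations of ℤ/N

  infixl 6 _⊕_

  -- Offsets are natural numbers, so subtracting `a` means adding `N ∸ a`.
  _⊕_ : Fin N → ℕ → Fin N
  i ⊕ a = (toℕ i + a) mod N

  toℕ-⊕ : ∀ i a → toℕ (i ⊕ a) ≡ (toℕ i + a) % N
  toℕ-⊕ i a = Fin.toℕ-fromℕ< (m%n<n (toℕ i + a) N)

  [a%N+b]%N : ∀ a b → (a % N + b) % N ≡ (a + b) % N
  [a%N+b]%N a b = begin
    (a % N + b) % N         ≡⟨ %-distribˡ-+ (a % N) b N ⟩
    (a % N % N + b % N) % N ≡⟨ cong (λ x → (x + b % N) % N) (m%n%n≡m%n a N) ⟩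
    (a % N + b % N) % N     ≡⟨ %-distribˡ-+ a b N ⟨
    (a + b) % N             ∎
    where open ≡-Reasoning

  ⊕-assoc : ∀ i a b → i ⊕ a ⊕ b ≡ i ⊕ (a + b)
  ⊕-assoc i a b = Fin.toℕ-injective (begin
    toℕ (i ⊕ a ⊕ b)           ≡⟨ toℕ-⊕ (i ⊕ a) b ⟩
    (toℕ (i ⊕ a) + b) % N     ≡⟨ cong (λ x → (x + b) % N) (toℕ-⊕ i a) ⟩
    ((toℕ i + a) % N + b) % N ≡⟨ [a%N+b]%N (toℕ i + a) b ⟩
    (toℕ i + a + b) % N       ≡⟨ cong (_% N) (ℕ.+-assoc (toℕ i) a b) ⟩
    (toℕ i + (a + b)) % N     ≡⟨ toℕ-⊕ i (a + b) ⟨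
    toℕ (i ⊕ (a + b))         ∎)
    where open ≡-Reasoning

  toℕ%N : ∀ i → toℕ i % N ≡ toℕ i
  toℕ%N i = m<n⇒m%n≡m (Fin.toℕ<n i)

  ⊕-identity : ∀ i → i ⊕ 0 ≡ i
  ⊕-identity i = Fin.toℕ-injective
    (trans (toℕ-⊕ i 0) (trans (cong (_% N) (ℕ.+-identityʳ (toℕ i))) (toℕ%N i)))

  ⊕-period : ∀ i → i ⊕ N ≡ i
  ⊕-period i = Fin.toℕ-injective
    (trans (toℕ-⊕ i N) (trans ([m+n]%n≡m%n (toℕ i) N) (toℕ%N i)))

  ⊕-undo : ∀ i {a b} → a + b ≡ N → i ⊕ a ⊕ b ≡ i
  ⊕-undo i {a} {b} eq = trans (⊕-assoc i a b) (trans (cong (i ⊕_) eq) (⊕-period i))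

  toℕ+[N∸toℕ] : ∀ i → toℕ i + (N ∸ toℕ i) ≡ N
  toℕ+[N∸toℕ] i = ℕ.m+[n∸m]≡n (ℕ.<⇒≤ (Fin.toℕ<n i))

  -- Subtracting `i` again recovers the residue of the offset, which gives cancellation.
  ⊕-retract : ∀ i a → toℕ (i ⊕ a ⊕ (N ∸ toℕ i)) ≡ a % N
  ⊕-retract i a = begin
    toℕ (i ⊕ a ⊕ (N ∸ toℕ i))       ≡⟨ cong toℕ (⊕-assoc i a (N ∸ toℕ i)) ⟩
    toℕ (i ⊕ (a + (N ∸ toℕ i)))     ≡⟨ toℕ-⊕ i _ ⟩
    (toℕ i + (a + (N ∸ toℕ i))) % N ≡⟨ cong (_% N) (x∙yz≈y∙xz (toℕ i) a _) ⟩
    (a + (toℕ i + (N ∸ toℕ i))) % N ≡⟨ cong (λ x → (a + x) % N) (toℕ+[N∸toℕ] i) ⟩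
    (a + N) % N                     ≡⟨ [m+n]%n≡m%n a N ⟩
    a % N                           ∎
    where open ≡-Reasoning

  ⊕-cancelˡ-% : ∀ i {a b} → i ⊕ a ≡ i ⊕ b → a % N ≡ b % N
  ⊕-cancelˡ-% i {a} {b} eq =
    trans (sym (⊕-retract i a)) (trans (cong (λ j → toℕ (j ⊕ (N ∸ toℕ i))) eq) (⊕-retract i b))

  ⊕-cancelˡ : ∀ i {a b} → a < N → b < N → i ⊕ a ≡ i ⊕ b → a ≡ b
  ⊕-cancelˡ i a<N b<N eq =
    trans (sym (m<n⇒m%n≡m a<N)) (trans (⊕-cancelˡ-% i eq) (m<n⇒m%n≡m b<N))

  ⊕-fixed⇒∣ : ∀ i a → i ⊕ a ≡ i → N ∣ a
  ⊕-fixed⇒∣ i a eq = m%n≡0⇒n∣m a N (⊕-cancelˡ-% i (trans eq (sym (⊕-identity i))))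

  difference : ∀ i j → ∃[ a ] a < N × i ⊕ a ≡ j
  difference i j = a % N , m%n<n a N , Fin.toℕ-injective (begin
    toℕ (i ⊕ a % N)                     ≡⟨ toℕ-⊕ i (a % N) ⟩
    (toℕ i + a % N) % N                 ≡⟨ cong (_% N) (ℕ.+-comm (toℕ i) (a % N)) ⟩
    (a % N + toℕ i) % N                 ≡⟨ [a%N+b]%N a (toℕ i) ⟩
    (N ∸ toℕ i + toℕ j + toℕ i) % N     ≡⟨ cong (_% N) (xy∙z≈y∙xz (N ∸ toℕ i) (toℕ j) (toℕ i)) ⟩
    (toℕ j + (N ∸ toℕ i + toℕ i)) % N   ≡⟨ cong (λ x → (toℕ j + x) % N) (ℕ.m∸n+n≡m (ℕ.<⇒≤ (Fin.toℕ<n i))) ⟩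
    (toℕ j + N) % N                     ≡⟨ [m+n]%n≡m%n (toℕ j) N ⟩
    toℕ j % N                           ≡⟨ toℕ%N j ⟩
    toℕ j                               ∎)
    where
    open ≡-Reasoning
    -- This is `j - i` shifted by `N` to stay a natural number.
    a = N ∸ toℕ i + toℕ j

  -- Differences as single or double steps

  step : Fin m → ℕ
  step d = suc (toℕ d)

  step-surjective : ∀ {δ} → 0 < δ → δ ≤ m → ∃[ d ] step d ≡ δ
  step-surjective {suc δ} _ δ<m = Fin.fromℕ< δ<m , cong suc (Fin.toℕ-fromℕ< δ<m)

  -- As `N` is `2 * m + 1`, one of `a` and `N ∸ a` is at most `m`. The factor 1 is written out to
  -- match `gap κ` in `halves`.
  near : ∀ {a} → 0 < a → a < N → ∃[ d ] (a ≡ 1 * step d ⊎ a + 1 * step d ≡ N)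
  near {a} 0<a a<N with a ≤? m
  ... | yes a≤m with d , eq ← step-surjective 0<a a≤m =
    d , inj₁ (sym (trans (ℕ.*-identityˡ _) eq))
  ... | no a≰m = let d , eq = step-surjective (ℕ.m<n⇒0<n∸m a<N) N∸a≤m in
    d , inj₂ (trans (cong (a +_) (trans (ℕ.*-identityˡ _) eq)) (ℕ.m+[n∸m]≡n (ℕ.<⇒≤ a<N)))
    where
    N∸a≤m : N ∸ a ≤ m
    N∸a≤m = ℕ.m≤n+o⇒m∸n≤o N a (≤-trans
      (ℕ.≤-reflexive (cong (λ x → suc (m + x)) (ℕ.+-identityʳ m))) (ℕ.+-monoˡ-≤ m (ℕ.≰⇒> a≰m)))

  -- As `N` is odd, one of `a` and `N ∸ a` is even, and the step is half of it: `a / 2` or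
  -- `m ∸ a / 2`.
  far : ∀ {a} → 0 < a → a < N → ∃[ d ] (a ≡ 2 * step d ⊎ a + 2 * step d ≡ N)
  far {a} 0<a a<N with a % 2 | m≡m%n+[m/n]*n a 2 | m%n<n a 2
  ... | 0 | even | _ = let d , eq = step-surjective 0<q q≤m in
    d , inj₁ (trans even′ (cong (2 *_) (sym eq)))
    where
    even′ : a ≡ 2 * (a / 2)
    even′ = trans even (ℕ.*-comm (a / 2) 2)

    0<q : 0 < a / 2
    0<q = ℕ.*-cancelˡ-< 2 0 (a / 2) (subst (0 <_) even′ 0<a)

    q≤m : a / 2 ≤ m
    q≤m = ℕ.*-cancelˡ-≤ 2 (subst (_≤ 2 * m) even′ (s≤s⁻¹ a<N))
  ... | 1 | odd | _ = let d , eq = step-surjective (ℕ.m<n⇒0<n∸m q<m) (ℕ.m∸n≤m m (a / 2)) in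
    d , inj₂ (begin
      a + 2 * step d                      ≡⟨ cong₂ (λ x y → x + 2 * y) odd′ eq ⟩
      suc (2 * (a / 2)) + 2 * (m ∸ a / 2) ≡⟨ cong suc (ℕ.*-distribˡ-+ 2 (a / 2) (m ∸ a / 2)) ⟨
      suc (2 * (a / 2 + (m ∸ a / 2)))     ≡⟨ cong (suc ∘ (2 *_)) (ℕ.m+[n∸m]≡n (ℕ.<⇒≤ q<m)) ⟩
      N                                   ∎)
    where
    open ≡-Reasoning

    odd′ : a ≡ suc (2 * (a / 2))
    odd′ = trans odd (cong suc (ℕ.*-comm (a / 2) 2))

    q<m : a / 2 < m
    q<m = ℕ.*-cancelˡ-< 2 (a / 2) m (s≤s⁻¹ (subst (_< N) odd′ a<N))
  ... | suc (suc _) | _ | s≤s (s≤s ())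

  halves : ∀ κ {a} → 0 < a → a < N → ∃[ d ] (a ≡ gap κ * step d ⊎ a + gap κ * step d ≡ N)
  halves 0F = near
  halves 1F = far
  halves 2F = near

  -- Progressions as a triple system

  Triple : Set
  Triple = Fin N × Fin m

  point : Triple → Fin 3 → Fin N
  point (c , d) t = c ⊕ toℕ t * step d

  -- Steps are at most `m`, so offsets within a triple never exceed `2 * m` and can be compared
  -- without reduction.
  offset<N : ∀ {k} d → k ≤ 2 → k * step d < N
  offset<N d k≤2 = s≤s (ℕ.*-mono-≤ k≤2 (Fin.toℕ<n d))

  label≤2 : ∀ (t : Fin 3) → toℕ t ≤ 2
  label≤2 t = Fin.toℕ≤pred[n] t

  gap≤2 : ∀ κ → gap κ ≤ 2
  gap≤2 κ = ∣⇒≤ (gap∣2 κ)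

  point-injective : ∀ b {s t} → point b s ≡ point b t → s ≡ t
  point-injective (c , d) {s} {t} eq = Fin.toℕ-injective (ℕ.*-cancelʳ-≡ (toℕ s) (toℕ t) (step d)
    (⊕-cancelˡ c (offset<N d (label≤2 s)) (offset<N d (label≤2 t)) eq))

  point-upper : ∀ κ b → point b (upper κ) ≡ point b (lower κ) ⊕ gap κ * step (proj₂ b)
  point-upper κ (c , d) = begin
    c ⊕ toℕ (upper κ) * step d                    ≡⟨ cong (λ k → c ⊕ k * step d) (upper≡lower+gap κ) ⟩
    c ⊕ (toℕ (lower κ) + gap κ) * step d          ≡⟨ cong (c ⊕_) (ℕ.*-distribʳ-+ (step d) (toℕ (lower κ)) (gap κ)) ⟩
    c ⊕ (toℕ (lower κ) * step d + gap κ * step d) ≡⟨ ⊕-assoc c _ _ ⟨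
    c ⊕ toℕ (lower κ) * step d ⊕ gap κ * step d   ∎
    where open ≡-Reasoning

  -- The base point, found by walking back from `i`, of the progression that has `i` at label `t`.
  first : Fin N → Fin m → Fin 3 → Fin N
  first i d t = i ⊕ (N ∸ toℕ t * step d)

  point-first : ∀ i d t → point (first i d t , d) t ≡ i
  point-first i d t = ⊕-undo i (ℕ.m∸n+n≡m (ℕ.<⇒≤ (offset<N d (label≤2 t))))

  first-point : ∀ c d t → first (point (c , d) t) d t ≡ c
  first-point c d t = ⊕-undo c (ℕ.m+[n∸m]≡n (ℕ.<⇒≤ (offset<N d (label≤2 t))))

  apart : ∀ κ {i j} → i ≢ j →
    ∃[ d ] (i ⊕ gap κ * step d ≡ j ⊎ j ⊕ gap κ * step d ≡ i)
  apart κ {i} {j} i≢j with difference i j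
  ... | zero , _ , eq = contradiction (trans (sym (⊕-identity i)) eq) i≢j
  ... | suc a , a<N , refl with halves κ (s≤s z≤n) a<N
  ... | d , inj₁ eq = d , inj₁ (cong (i ⊕_) (sym eq))
  ... | d , inj₂ eq = d , inj₂ (⊕-undo i eq)

  chord : ∀ κ {i j} d → i ⊕ gap κ * step d ≡ j →
    ∃[ b ] point b (lower κ) ≡ i × point b (upper κ) ≡ j
  chord κ {i} d eq = b , point-first i d (lower κ) ,
    trans (point-upper κ b) (trans (cong (_⊕ gap κ * step d) (point-first i d (lower κ))) eq)
    where
    b : Triple
    b = first i d (lower κ) , d

  join : ∀ {i j} → i ≢ j → ∀ κ → ∃[ b ] ∃[ s ] ∃[ t ]
    point b s ≡ i × point b t ≡ j × third s t ≡ κ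
  join i≢j κ with apart κ i≢j
  ... | d , inj₁ eq with b , bl , bu ← chord κ d eq =
    b , lower κ , upper κ , bl , bu , third-lower-upper κ
  ... | d , inj₂ eq with b , bl , bu ← chord κ d eq =
    b , upper κ , lower κ , bu , bl , third-upper-lower κ

  -- Both offsets from the common lower point are below `N`, so they cancel to equal steps; the base
  -- is then recovered by `first`.
  parallel-unique : ∀ κ {b c} → point b (lower κ) ≡ point c (lower κ) →
    point b (upper κ) ≡ point c (upper κ) → b ≡ c
  parallel-unique κ {x , d} {y , e} lower-eq upper-eq = cong₂ _,_ x≡y d≡e
    where
    instance
      gap≢0 : NonZero (gap κ)
      gap≢0 = gap-nonZero κ

    d≡e : d ≡ e
    d≡e = Fin.toℕ-injective (ℕ.suc-injective (ℕ.*-cancelˡ-≡ (step d) (step e) (gap κ)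
      (⊕-cancelˡ (point (x , d) (lower κ)) (offset<N d (gap≤2 κ)) (offset<N e (gap≤2 κ)) (begin
        point (x , d) (lower κ) ⊕ gap κ * step d ≡⟨ point-upper κ (x , d) ⟨
        point (x , d) (upper κ)                  ≡⟨ upper-eq ⟩
        point (y , e) (upper κ)                  ≡⟨ point-upper κ (y , e) ⟩
        point (y , e) (lower κ) ⊕ gap κ * step e ≡⟨ cong (_⊕ gap κ * step e) lower-eq ⟨
        point (x , d) (lower κ) ⊕ gap κ * step e ∎))))
      where open ≡-Reasoning

    x≡y : x ≡ y
    x≡y = trans (sym (first-point x d (lower κ)))
      (trans (cong₂ (λ i d → first i d (lower κ)) lower-eq d≡e) (first-point y e (lower κ)))

  -- `gap κ` divides 2, and `N` is odd.
  gap-coprime : ∀ κ → Coprime N (gap κ)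
  gap-coprime κ {k} (k∣N , k∣gap) = ∣1⇒≡1 (∣m+n∣m⇒∣n (subst (k ∣_) (ℕ.+-comm 1 (2 * m)) k∣N)
    (∣m⇒∣m*n m (∣-trans k∣gap (gap∣2 κ))))

  -- Otherwise going up along `b` and then along `c` would come full circle, so `N` would divide
  -- `gap κ` times the sum of the two steps. By coprimality it would divide the sum, which is
  -- positive and at most `2 * m`.
  not-antiparallel : ∀ κ {b c} → point b (lower κ) ≡ point c (upper κ) →
    point b (upper κ) ≢ point c (lower κ)
  not-antiparallel κ {b@(_ , d)} {c@(_ , e)} lower-eq upper-eq =
    ℕ.<-irrefl refl (ℕ.<-≤-trans small (∣⇒≤ divisible))
    where
    i : Fin N
    i = point b (lower κ)

    small : step d + step e < N
    small = s≤s (≤-trans (ℕ.+-mono-≤ (Fin.toℕ<n d) (Fin.toℕ<n e))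
      (ℕ.≤-reflexive (cong (m +_) (sym (ℕ.+-identityʳ m)))))

    around : i ⊕ gap κ * (step d + step e) ≡ i
    around = begin
      i ⊕ gap κ * (step d + step e)         ≡⟨ cong (i ⊕_) (ℕ.*-distribˡ-+ (gap κ) (step d) (step e)) ⟩
      i ⊕ (gap κ * step d + gap κ * step e) ≡⟨ ⊕-assoc i _ _ ⟨
      i ⊕ gap κ * step d ⊕ gap κ * step e   ≡⟨ cong (_⊕ gap κ * step e) (point-upper κ b) ⟨
      point b (upper κ) ⊕ gap κ * step e    ≡⟨ cong (_⊕ gap κ * step e) upper-eq ⟩
      point c (lower κ) ⊕ gap κ * step e    ≡⟨ point-upper κ c ⟨
      point c (upper κ)                     ≡⟨ lower-eq ⟨
      i                                     ∎
      where open ≡-Reasoning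

    divisible : N ∣ step d + step e
    divisible = coprime-divisor (gap-coprime κ) (⊕-fixed⇒∣ i _ around)

  -- Equal third labels leave the same two labels on both triples. They match up in equal order,
  -- where `parallel-unique` applies, or in opposite order, which `not-antiparallel` excludes.
  join-unique : ∀ {b c s s′ t t′} → point b s ≡ point c s′ → point b t ≡ point c t′ →
    s ≢ t → s′ ≢ t′ → third s t ≡ third s′ t′ → b ≡ c
  join-unique {b} {c} {s} {s′} {t} {t′} p q s≢t s′≢t′ eq
    with third s t | third s′ t′ | eq | orient s≢t | orient s′≢t′
  ... | κ | _ | refl | inj₁ (refl , refl) | inj₁ (refl , refl) = parallel-unique κ p q
  ... | κ | _ | refl | inj₂ (refl , refl) | inj₂ (refl , refl) = parallel-unique κ q p
  ... | κ | _ | refl | inj₁ (refl , refl) | inj₂ (refl , refl) = contradiction q (not-antiparallel κ {b} {c} p)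
  ... | κ | _ | refl | inj₂ (refl , refl) | inj₁ (refl , refl) = contradiction p (not-antiparallel κ {b} {c} q)

  -- Each choice of a step and a label yields exactly one progression through `i`, hence `m * 3`
  -- flags.
  flag : Fin N → Fin (m * 3) → Triple × Fin 3
  flag i k = let d , t = remQuot 3 k in (first i d t , d) , t

  flag-injective : ∀ i {k l} → flag i k ≡ flag i l → k ≡ l
  flag-injective i {k} {l} eq = trans (sym (Fin.combine-remQuot {m} 3 k))
    (trans (cong₂ combine (cong (proj₂ ∘ proj₁) eq) (cong proj₂ eq)) (Fin.combine-remQuot {m} 3 l))

  flag-complete : ∀ b t → ∃[ k ] flag (point b t) k ≡ (b , t)
  flag-complete (c , d) t = combine d t , (begin
    flag i (combine d t)     ≡⟨ cong (λ (e , s) → (first i e s , e) , s) (Fin.remQuot-combine d t) ⟩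
    (first i d t , d) , t    ≡⟨ cong (λ x → (x , d) , t) (first-point c d t) ⟩
    (c , d) , t              ∎)
    where
    open ≡-Reasoning

    i : Fin N
    i = point (c , d) t

  tripleSystem : TripleSystem (m * 3)
  tripleSystem = record
    { Point           = Fin N
    ; Triple          = Triple
    ; _≟ᵖ_            = Fin._≟_
    ; _≟ᵗ_            = Product.≡-dec Fin._≟_ Fin._≟_
    ; point           = point
    ; point-injective = point-injective
    ; join            = join
    ; join-unique     = join-unique
    ; flag            = flag
    ; flag-injective  = flag-injective
    ; flag-incident   = λ i k → let d , t = remQuot 3 k in point-first i d t
    ; flag-complete   = flag-complete
    }

  -- Order and degree of the cyclic graph

  open Inflation tripleSystem public

  order : HasOrder G (N + N * m * 3)
  order = (↔-id _ ⊎-↔ ((*↔× ×-↔ ↔-id _) ↔-∘ *↔×)) ↔-∘ +↔⊎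

  order≡ : N * (3 * N ∸ 1) / 2 ≡ N + N * m * 3
  order≡ = begin
    N * (3 * N ∸ 1) / 2       ≡⟨ cong (λ x → N * x / 2) (3N∸1 m) ⟩
    N * ((1 + m * 3) * 2) / 2 ≡⟨ cong (_/ 2) (ℕ.*-assoc N (1 + m * 3) 2) ⟨
    N * (1 + m * 3) * 2 / 2   ≡⟨ m*n/n≡m (N * (1 + m * 3)) 2 ⟩
    N * (1 + m * 3)           ≡⟨ ℕ.*-suc N (m * 3) ⟩
    N + N * (m * 3)           ≡⟨ cong (N +_) (ℕ.*-assoc N m 3) ⟨
    N + N * m * 3             ∎
    where
    open ≡-Reasoning

    -- The left side is what `3 * N ∸ 1` computes to; being free of subtraction, it suits the
    -- semiring solver.
    3N∸1 : ∀ m → 2 * m + (suc (2 * m) + (suc (2 * m) + 0)) ≡ (1 + m * 3) * 2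
    3N∸1 = solve-∀

  degree≡ : 3 * (N ∸ 1) / 2 ≡ m * 3
  degree≡ = trans (cong (_/ 2) (regroup m)) (m*n/n≡m (m * 3) 2)
    where
    regroup : ∀ m → 3 * (2 * m) ≡ m * 3 * 2
    regroup = solve-∀

-- Odd orders and the final choice of witnesses

odd⇒suc-double : ∀ n → n % 2 ≡ 1 → 5 ≤ n → ∃[ m ] n ≡ suc (2 * (2 + m))
odd⇒suc-double n odd 5≤n with n / 2 | subst (λ r → n ≡ r + n / 2 * 2) odd (m≡m%n+[m/n]*n n 2)
odd⇒suc-double _ _ (s≤s ())             | 0 | refl
odd⇒suc-double _ _ (s≤s (s≤s (s≤s ()))) | 1 | refl
... | suc (suc m) | n≡ = m , trans n≡ (cong suc (ℕ.*-comm (2 + m) 2))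

construction : ∀ m → let n = suc (2 * (2 + m)) in
  ∃[ G ] HasOrder G (n * (3 * n ∸ 1) / 2)
  × 3 -Connected G
  × Biregular G (3 * (n ∸ 1) / 2) 3
  × Trigeodetic G
  × Block G
  × (Diameter G 4 ⊎ Diameter G 5)
construction m =
  G
  , subst (HasOrder G) (sym order≡) order
  , 3-connected b
  -- The hub degree `(2 + m) * 3` computes to at least six successors, so it cannot be 3.
  , subst (λ l → Biregular G l 3) (sym degree≡) (biregular λ ())
  , trigeodetic
  , (3 , s≤s (s≤s z≤n) , 3-connected b)
  , diameter-4-or-5 order b (Fin.zero ⊕ 3) 3∉b
  where
  open Cyclic (2 + m)

  -- The progression 0, 1, 2 with step 1; the point 3 lies off it since `N` exceeds 3.
  b : Triple
  b = Fin.zero , Fin.zero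

  3<N : 3 < N
  3<N = subst (3 <_) (cong suc (ℕ.*-comm (2 + m) 2)) (s≤s (s≤s (s≤s (s≤s z≤n))))

  3∉b : ∀ t → point b t ≢ Fin.zero ⊕ 3
  3∉b t eq with ⊕-cancelˡ Fin.zero (offset<N {toℕ t} Fin.zero (label≤2 t)) 3<N eq
  3∉b 0F _ | ()
  3∉b 1F _ | ()
  3∉b 2F _ | ()

theorem7 : (n : ℕ) → n % 2 ≡ 1 → 5 ≤ n →
    ∃[ G ] HasOrder G (n * (3 * n ∸ 1) / 2)
    × 3 -Connected G
    × Biregular G (3 * (n ∸ 1) / 2) 3
    × Trigeodetic G
    × Block G
    × (Diameter G 4 ⊎ Diameter G 5)
theorem7 n odd 5≤n with m , refl ← odd⇒suc-double n odd 5≤n = construction m
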